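{- For any graph $G$ and any bipartite graph $H$ in which all vertex degrees are odd, $\alpha_{\mathrm{od}}(\mu[G,H])\ge \frac12|H|\cdot\alpha_{\mathrm{od}}(G\,\Box\,K_2)$.
   Context: For graphs $G$ and $H$, $\mu[G,H]$ is the graph obtained by replacing each vertex $w\in V(H)$ with a copy $G_w$ of $G$ and, for every edge $w_1w_2\in E(H)$, adding the perfect matching between $G_{w_1}$ and $G_{w_2}$ joining the two copies of each vertex of $G$. $G\,\Box\,K_2$ is the Cartesian product of $G$ with an edge (two copies of $G$ with a perfect matching between corresponding vertices). An odd independent set in a graph $F=(V,E)$ is an independent set $S$ such that every $v\in V\setminus S$ has either no neighbor or an odd number of neighbors in $S$; $\alpha_{\mathrm{od}}(F)$ is the maximum size of such a set. $|H|$ is the number of vertices. -}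

module Defs where

open import Data.Bool using (Bool)
open import Data.Fin using (Fin; combine; remQuot)
open import Data.Fin.Properties using (_≟_; all?)
open import Data.Fin.Subset using (Subset; inside; outside; _∈_; _∉_; _∩_; ∣_∣) renaming (⊥ to ∅)
open import Data.Fin.Subset.Properties using (_∈?_; ∉⊥; ∣⊥∣≡0; ∩-zeroʳ)
open import Data.List using (List; []; _∷_; _++_; map; filter)
open import Data.List.Extrema.Nat using (argmax; argmax-all; f[xs]≤f[argmax])
open import Data.List.Membership.Propositional renaming (_∈_ to _∈ᴸ_) using ()
open import Data.List.Membership.Propositional.Properties using (∈-map⁺; ∈-++⁺ˡ; ∈-++⁺ʳ; ∈-filter⁺)
open import Data.List.Relation.Unary.All as All using ()
open import Data.List.Relation.Unary.All.Properties using (all-filter)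
open import Data.List.Relation.Unary.Any using (here)
open import Data.Nat using (ℕ; zero; suc; _*_; _≤_; parity)
import Data.Nat.Properties as ℕ
open import Data.Parity.Base using (1ℙ)
import Data.Parity.Properties as ℙ
open import Data.Product using (Σ-syntax; ∃; _×_; _,_)
open import Data.Sum using (_⊎_; inj₁; inj₂)
open import Data.Vec using ([]; _∷_; tabulate)
open import Relation.Binary using (Symmetric; Irreflexive) renaming (Decidable to Decidable₂)
open import Relation.Binary.PropositionalEquality using (_≡_; _≢_; refl; sym; trans; cong; ≢-sym)
open import Relation.Nullary using (¬_; Dec; does; ¬?)
open import Relation.Nullary.Decidable using (map′; _×-dec_; _⊎-dec_; _→-dec_)

-- Finite simple graphs on the vertex set Fin order.
record Graph : Set₁ where
  field
    order  : ℕ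
    Adj    : Fin order → Fin order → Set
    adj?   : Decidable₂ Adj
    symm   : Symmetric Adj
    irrefl : Irreflexive _≡_ Adj

  Vertex : Set
  Vertex = Fin order

  neighbours : Vertex → Subset order
  neighbours v = tabulate (λ u → does (adj? v u))

  degree : Vertex → ℕ
  degree v = ∣ neighbours v ∣

open Graph

Odd : ℕ → Set
Odd n = parity n ≡ 1ℙ

Bipartite : Graph → Set
Bipartite H = Σ[ colour ∈ (Vertex H → Bool) ] (∀ u v → Adj H u v → colour u ≢ colour v)

AllDegreesOdd : Graph → Set
AllDegreesOdd H = ∀ v → Odd (degree H v)

-- A graph on Fin m × Fin n, carried over to Fin (m * n) along the library
-- bijection remQuot / combine.
module _ {m n : ℕ} (R : Fin m × Fin n → Fin m × Fin n → Set)
         (R? : Decidable₂ R) (R-sym : Symmetric R) (R-irrefl : Irreflexive _≡_ R) where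

  pairGraph : Graph
  pairGraph = record
    { order  = m * n
    ; Adj    = λ x y → R (remQuot n x) (remQuot n y)
    ; adj?   = λ x y → R? (remQuot n x) (remQuot n y)
    ; symm   = R-sym
    ; irrefl = λ x≡y → R-irrefl (cong (remQuot n) x≡y)
    }

-- The vertex (w , v) is the copy of v ∈ V(G) lying in G_w.
data μAdj (G H : Graph) : Vertex H × Vertex G → Vertex H × Vertex G → Set where
  inCopy   : ∀ {w v₁ v₂} → Adj G v₁ v₂ → μAdj G H (w , v₁) (w , v₂)
  matching : ∀ {w₁ w₂ v} → Adj H w₁ w₂ → μAdj G H (w₁ , v) (w₂ , v)

□Adj : (G H : Graph) → Vertex G × Vertex H → Vertex G × Vertex H → Set
□Adj G H (u , x) (v , y) = (u ≡ v × Adj H x y) ⊎ (Adj G u v × x ≡ y)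

module _ (G H : Graph) where

  μAdj? : Decidable₂ (μAdj G H)
  μAdj? (w₁ , v₁) (w₂ , v₂) =
    map′ to from ((w₁ ≟ w₂ ×-dec adj? G v₁ v₂) ⊎-dec (adj? H w₁ w₂ ×-dec v₁ ≟ v₂))
    where
    to : ∀ {w₁ w₂ v₁ v₂} → (w₁ ≡ w₂ × Adj G v₁ v₂) ⊎ (Adj H w₁ w₂ × v₁ ≡ v₂) →
         μAdj G H (w₁ , v₁) (w₂ , v₂)
    to (inj₁ (refl , e)) = inCopy e
    to (inj₂ (e , refl)) = matching e
    from : ∀ {w₁ w₂ v₁ v₂} → μAdj G H (w₁ , v₁) (w₂ , v₂) →
           (w₁ ≡ w₂ × Adj G v₁ v₂) ⊎ (Adj H w₁ w₂ × v₁ ≡ v₂)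
    from (inCopy e)   = inj₁ (refl , e)
    from (matching e) = inj₂ (e , refl)

  μAdj-sym : Symmetric (μAdj G H)
  μAdj-sym (inCopy e)   = inCopy (symm G e)
  μAdj-sym (matching e) = matching (symm H e)

  μAdj-irrefl : Irreflexive _≡_ (μAdj G H)
  μAdj-irrefl refl (inCopy e)   = irrefl G refl e
  μAdj-irrefl refl (matching e) = irrefl H refl e

  μ[_,_] : Graph
  μ[_,_] = pairGraph (μAdj G H) μAdj? μAdj-sym μAdj-irrefl

  □Adj? : Decidable₂ (□Adj G H)
  □Adj? (u , x) (v , y) = (u ≟ v ×-dec adj? H x y) ⊎-dec (adj? G u v ×-dec x ≟ y)

  □Adj-sym : Symmetric (□Adj G H)
  □Adj-sym (inj₁ (p , e)) = inj₁ (sym p , symm H e)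
  □Adj-sym (inj₂ (e , p)) = inj₂ (symm G e , sym p)

  □Adj-irrefl : Irreflexive _≡_ (□Adj G H)
  □Adj-irrefl refl (inj₁ (_ , e)) = irrefl H refl e
  □Adj-irrefl refl (inj₂ (e , _)) = irrefl G refl e

  infixl 7 _□_
  _□_ : Graph
  _□_ = pairGraph (□Adj G H) □Adj? □Adj-sym □Adj-irrefl

K : ℕ → Graph
K n = record
  { order  = n
  ; Adj    = _≢_
  ; adj?   = λ u v → ¬? (u ≟ v)
  ; symm   = ≢-sym
  ; irrefl = λ p q → q p
  }

module _ (F : Graph) where

  Independent : Subset (order F) → Set
  Independent S = ∀ u v → u ∈ S → v ∈ S → ¬ Adj F u v

  neighboursIn : Subset (order F) → Vertex F → ℕ
  neighboursIn S v = ∣ neighbours F v ∩ S ∣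

  OddIndependent : Subset (order F) → Set
  OddIndependent S =
    Independent S × (∀ v → v ∉ S → neighboursIn S v ≡ 0 ⊎ Odd (neighboursIn S v))

  oddIndependent? : ∀ S → Dec (OddIndependent S)
  oddIndependent? S =
    all? (λ u → all? λ v → (u ∈? S) →-dec ((v ∈? S) →-dec ¬? (adj? F u v)))
    ×-dec
    all? (λ v → ¬? (v ∈? S) →-dec
      ((neighboursIn S v ℕ.≟ 0) ⊎-dec (parity (neighboursIn S v) ℙ.≟ 1ℙ)))

  ∅-oddIndependent : OddIndependent ∅
  ∅-oddIndependent =
    (λ _ _ u∈∅ _ _ → ∉⊥ u∈∅) ,
    (λ v _ → inj₁ (trans (cong ∣_∣ (∩-zeroʳ (neighbours F v))) (∣⊥∣≡0 (order F))))

subsets : ∀ n → List (Subset n)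
subsets zero    = [] ∷ []
subsets (suc n) = map (outside ∷_) (subsets n) ++ map (inside ∷_) (subsets n)

∈-subsets : ∀ {n} (S : Subset n) → S ∈ᴸ subsets n
∈-subsets []            = here refl
∈-subsets (outside ∷ S) = ∈-++⁺ˡ (∈-map⁺ (outside ∷_) (∈-subsets S))
∈-subsets {suc n} (inside ∷ S) =
  ∈-++⁺ʳ (map (outside ∷_) (subsets n)) (∈-map⁺ (inside ∷_) (∈-subsets S))

module _ (F : Graph) where

  oddIndependentSets : List (Subset (order F))
  oddIndependentSets = filter (oddIndependent? F) (subsets (order F))

  -- The default ∅ of argmax is itself odd independent, so it does not affect the maximum.
  maxOddIndependent : Subset (order F)
  maxOddIndependent = argmax ∣_∣ ∅ oddIndependentSets

  α-od : ℕ
  α-od = ∣ maxOddIndependent ∣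

  α-od-attained : ∃ λ S → OddIndependent F S × ∣ S ∣ ≡ α-od
  α-od-attained =
    maxOddIndependent ,
    argmax-all ∣_∣ (∅-oddIndependent F) (all-filter (oddIndependent? F) (subsets (order F))) ,
    refl

  α-od-upper : ∀ S → OddIndependent F S → ∣ S ∣ ≤ α-od
  α-od-upper S oi =
    All.lookup (f[xs]≤f[argmax] ∅ oddIndependentSets)
               (∈-filter⁺ (oddIndependent? F) (∈-subsets S) oi)

{-# OPTIONS --safe #-}
module Submission where

-- Let S be a maximum odd independent set of G □ K₂, with layers S₀, S₁ ⊆ V(G).
-- For a proper 2-colouring κ of H, place the layer S_{κ w} in every copy G_w.
-- A vertex (w , v) of μ[G , H] has as many neighbours inside G_w as (v , κ w) has
-- inside its layer, and its deg w matching neighbours all carry the layer opposite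
-- to κ w; since deg w is odd, replacing the single matching edge of G □ K₂ by
-- deg w edges changes neither the parity of the count nor whether it vanishes.
-- The sets obtained from κ and from the opposite colouring have |H| · |S|
-- elements together, so the larger one has at least half as many.

open import Data.Nat using (ℕ; zero; suc; _+_; _*_; _≤_; parity)
open import Defs
open import Data.Bool using (Bool; true; false; _∧_)
open import Data.Fin using (Fin; zero; suc; combine; remQuot; opposite; _↑ˡ_; _↑ʳ_)
open import Data.Fin.Properties using (_≟_; remQuot-combine)
open import Data.Fin.Subset using (Subset; _∈_; _∩_; ∣_∣)
open import Data.Nat.Properties using (+-assoc; +-comm; +-identityʳ; *-identityˡ; *-zeroʳ; *-identityʳ; +-mono-≤; +-0-commutativeMonoid; +-*-semiring; module ≤-Reasoning)
open import Data.Parity.Base using (1ℙ) renaming (_+_ to _ℙ+_)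
open import Data.Parity.Properties using (+-homo-+)
open import Data.Product using (_×_; _,_; proj₁; proj₂)
open import Data.Sum using (_⊎_; inj₁; inj₂)
open import Data.Vec using (_∷_; []; lookup; tabulate)
open import Data.Vec.Properties using ([]=⇒lookup; lookup⇒[]=; lookup∘tabulate; lookup-zipWith)
open import Function using (_∘_)
open import Relation.Binary.PropositionalEquality using (_≡_; _≢_; refl; sym; trans; cong; cong₂; subst; subst₂; module ≡-Reasoning)
open import Relation.Nullary using (yes; no; does; contradiction)
open import Algebra.Properties.CommutativeMonoid.Sum +-0-commutativeMonoid using (sum; sum-cong-≗; sum-replicate-zero; ∑-distrib-+; sum-syntax)
open import Algebra.Properties.Semiring.Sum +-*-semiring using (*-distribˡ-sum; *-distribʳ-sum)

open Graph

-- Cardinalities as sums of indicators.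

⟦_⟧ : Bool → ℕ
⟦ false ⟧ = 0
⟦ true  ⟧ = 1

sum-const : ∀ n c → sum {n} (λ _ → c) ≡ n * c
sum-const zero    c = refl
sum-const (suc n) c = cong (c +_) (sum-const n c)

sum-⟦≟⟧ : ∀ {n} (i : Fin n) (f : Fin n → ℕ) →
          ∑[ j < n ] (⟦ does (i ≟ j) ⟧ * f j) ≡ f i
sum-⟦≟⟧ {suc n} zero    f =
  trans (cong₂ _+_ (*-identityˡ (f zero)) (sum-replicate-zero n)) (+-identityʳ (f zero))
sum-⟦≟⟧ {suc n} (suc i) f = sum-⟦≟⟧ i (f ∘ suc)

sum-↑ : ∀ m {n} (f : Fin (m + n) → ℕ) →
        sum f ≡ ∑[ i < m ] f (i ↑ˡ n) + ∑[ j < n ] f (m ↑ʳ j)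
sum-↑ zero    f = refl
sum-↑ (suc m) f =
  trans (cong (f zero +_) (sum-↑ m (f ∘ suc))) (sym (+-assoc (f zero) _ _))

-- Turns a count over the vertices of a `pairGraph` into a double sum over coordinates.
sum-combine : ∀ m {n} (f : Fin (m * n) → ℕ) →
              sum f ≡ ∑[ i < m ] ∑[ j < n ] f (combine i j)
sum-combine zero        f = refl
sum-combine (suc m) {n} f =
  trans (sum-↑ n f) (cong (∑[ j < n ] f (j ↑ˡ (m * n)) +_) (sum-combine m (λ j → f (n ↑ʳ j))))

∣∣≡sum : ∀ {n} (S : Subset n) → ∣ S ∣ ≡ ∑[ i < n ] ⟦ lookup S i ⟧
∣∣≡sum []          = refl
∣∣≡sum (true  ∷ S) = cong suc (∣∣≡sum S)
∣∣≡sum (false ∷ S) = ∣∣≡sum S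

∣tabulate∣≡sum : ∀ {n} (f : Fin n → Bool) → ∣ tabulate f ∣ ≡ ∑[ i < n ] ⟦ f i ⟧
∣tabulate∣≡sum f =
  trans (∣∣≡sum (tabulate f)) (sum-cong-≗ λ i → cong ⟦_⟧ (lookup∘tabulate f i))

neighboursIn≡sum : ∀ F S v →
  neighboursIn F S v ≡ ∑[ u < order F ] ⟦ does (adj? F v u) ∧ lookup S u ⟧
neighboursIn≡sum F S v = trans (∣∣≡sum (neighbours F v ∩ S)) (sum-cong-≗ λ u →
  cong ⟦_⟧ (trans (lookup-zipWith _∧_ u (neighbours F v) S)
                  (cong (_∧ lookup S u) (lookup∘tabulate _ u))))

-- Neighbour counts in a Cartesian product.

module _ (G H : Graph) where

  -- The two kinds of adjacency exclude each other, since `u ≡ v` rules out `Adj G u v` by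
  -- irreflexivity; hence the indicator of the disjunction is a sum. Each equality becomes a
  -- Kronecker delta, which `sum-⟦≟⟧` later collapses.
  ⟦□Adj⟧ : ∀ u x v y s →
    ⟦ does (□Adj? G H (u , x) (v , y)) ∧ s ⟧ ≡
    ⟦ does (u ≟ v) ⟧ * ⟦ does (adj? H x y) ∧ s ⟧ + ⟦ does (x ≟ y) ⟧ * ⟦ does (adj? G u v) ∧ s ⟧
  ⟦□Adj⟧ u x v y s with u ≟ v | adj? G u v | x ≟ y
  ... | yes p | yes e | _     = contradiction e (irrefl G p)
  ... | yes _ | no  _ | d rewrite *-zeroʳ ⟦ does d ⟧ with does (adj? H x y)
  ...   | true  = sym (trans (+-identityʳ _) (+-identityʳ _))
  ...   | false = refl
  ⟦□Adj⟧ u x v y s | no _ | yes _ | yes _ = sym (+-identityʳ _)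
  ⟦□Adj⟧ u x v y s | no _ | yes _ | no  _ = refl
  ⟦□Adj⟧ u x v y s | no _ | no  _ | d     = sym (*-zeroʳ ⟦ does d ⟧)

  module _ (S : Subset (order G * order H)) where

    -- The coordinates of `p` enter through an equation so that the formula serves both an arbitrary
    -- `p`, by `refl`, and a `p` built by `combine`, by `remQuot-combine`.
    neighboursIn-□ : ∀ p {u x} → remQuot (order H) p ≡ (u , x) →
      neighboursIn (G □ H) S p ≡
        ∑[ y < order H ] ⟦ does (adj? H x y) ∧ lookup S (combine u y) ⟧ +
        ∑[ v < order G ] ⟦ does (adj? G u v) ∧ lookup S (combine v x) ⟧
    neighboursIn-□ p {u} {x} p≡ux = begin
      neighboursIn (G □ H) S p
        ≡⟨ neighboursIn≡sum (G □ H) S p ⟩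
      sum (λ i → ⟦ does (□Adj? G H (remQuot n p) (remQuot n i)) ∧ lookup S i ⟧)
        ≡⟨ sum-combine m _ ⟩
      ∑[ v < m ] ∑[ y < n ] ⟦ does (□Adj? G H (remQuot n p) (remQuot n (combine v y))) ∧ s v y ⟧
        ≡⟨ (sum-cong-≗ λ v → sum-cong-≗ λ y → trans
             (cong₂ (λ q r → ⟦ does (□Adj? G H q r) ∧ s v y ⟧) p≡ux (remQuot-combine v y))
             (⟦□Adj⟧ u x v y (s v y))) ⟩
      ∑[ v < m ] ∑[ y < n ] (⟦ does (u ≟ v) ⟧ * h v y + ⟦ does (x ≟ y) ⟧ * g v y)
        ≡⟨ (sum-cong-≗ λ v → trans (∑-distrib-+ (λ y → ⟦ does (u ≟ v) ⟧ * h v y) _)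
             (cong₂ _+_ (sym (*-distribˡ-sum ⟦ does (u ≟ v) ⟧ (h v))) (sum-⟦≟⟧ x (g v)))) ⟩
      ∑[ v < m ] (⟦ does (u ≟ v) ⟧ * ∑[ y < n ] h v y + g v x)
        ≡⟨ ∑-distrib-+ (λ v → ⟦ does (u ≟ v) ⟧ * sum (h v)) _ ⟩
      ∑[ v < m ] (⟦ does (u ≟ v) ⟧ * ∑[ y < n ] h v y) + ∑[ v < m ] g v x
        ≡⟨ cong (_+ ∑[ v < m ] g v x) (sum-⟦≟⟧ u (λ v → sum (h v))) ⟩
      ∑[ y < n ] h u y + ∑[ v < m ] g v x ∎
      where
      open ≡-Reasoning
      m = order G
      n = order H
      s : Fin m → Fin n → Bool
      s v y = lookup S (combine v y)
      h g : Fin m → Fin n → ℕ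
      h v y = ⟦ does (adj? H x y) ∧ s v y ⟧
      g v y = ⟦ does (adj? G u v) ∧ s v y ⟧

-- Parity, the two vertices of `K 2`, and 2-colourings.

sum-K₂ : ∀ (x : Fin 2) (f : Fin 2 → Bool) →
         ∑[ y < 2 ] ⟦ does (adj? (K 2) x y) ∧ f y ⟧ ≡ ⟦ f (opposite x) ⟧
sum-K₂ zero       f = +-identityʳ _
sum-K₂ (suc zero) f = +-identityʳ _

-- If `b` is false, both counts are `a`. If `b` is true, the first count `1 + a` is nonzero, hence
-- odd, and `d + a` has the same parity because `d` is odd like 1.
0-or-odd-* : ∀ d → Odd d → ∀ b a →
             ⟦ b ⟧ + a ≡ 0 ⊎ Odd (⟦ b ⟧ + a) →
             d * ⟦ b ⟧ + a ≡ 0 ⊎ Odd (d * ⟦ b ⟧ + a)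
0-or-odd-* d _  false a P rewrite *-zeroʳ d = P
0-or-odd-* d od true  a (inj₂ o) rewrite *-identityʳ d = inj₂ (begin
  parity (d + a)         ≡⟨ +-homo-+ d a ⟩
  parity d ℙ+ parity a   ≡⟨ cong (_ℙ+ parity a) od ⟩
  1ℙ ℙ+ parity a         ≡⟨ +-homo-+ 1 a ⟨
  parity (1 + a)         ≡⟨ o ⟩
  1ℙ                     ∎)
  where open ≡-Reasoning

opposite-≢ : ∀ (x : Fin 2) → x ≢ opposite x
opposite-≢ zero       ()
opposite-≢ (suc zero) ()

sum-opposite : ∀ (x : Fin 2) (f : Fin 2 → ℕ) → f x + f (opposite x) ≡ ∑[ y < 2 ] f y
sum-opposite zero       f = cong (f zero +_) (sym (+-identityʳ _))
sum-opposite (suc zero) f = trans (+-comm (f (suc zero)) _) (cong (f zero +_) (sym (+-identityʳ _)))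

-- Colours are vertices of `K 2`, and properness is an equation so that it can be used to rewrite.
Proper₂ : (H : Graph) → (Vertex H → Fin 2) → Set
Proper₂ H κ = ∀ u v → Adj H u v → κ v ≡ opposite (κ u)

opposite-proper : ∀ H {κ} → Proper₂ H κ → Proper₂ H (opposite ∘ κ)
opposite-proper H proper u v e = cong opposite (proper u v e)

-- Lifting a set from `G □ K 2` to `μ[ G , H ]`.

module _ (G H : Graph) (S : Subset (order G * 2)) where

  -- The projection of `μ[ G , H ]` to `G □ K 2` induced by `κ`; `lift κ` is the preimage of `S`
  -- under it.
  layer : Vertex H × Vertex G → (Vertex H → Fin 2) → Fin (order G * 2)
  layer (w , v) κ = combine v (κ w)

  lift : (Vertex H → Fin 2) → Subset (order H * order G)
  lift κ = tabulate λ p → lookup S (layer (remQuot (order G) p) κ)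

  ∈-lift⁻ : ∀ κ p → p ∈ lift κ → layer (remQuot (order G) p) κ ∈ S
  ∈-lift⁻ κ p p∈ = lookup⇒[]= _ S (trans (sym (lookup∘tabulate _ p)) ([]=⇒lookup p∈))

  ∈-lift⁺ : ∀ κ p → layer (remQuot (order G) p) κ ∈ S → p ∈ lift κ
  ∈-lift⁺ κ p ∈S = lookup⇒[]= p (lift κ) (trans (lookup∘tabulate _ p) ([]=⇒lookup ∈S))

  lookup-lift : ∀ κ w v → lookup (lift κ) (combine w v) ≡ lookup S (combine v (κ w))
  lookup-lift κ w v = trans (lookup∘tabulate _ (combine w v))
    (cong (λ q → lookup S (layer q κ)) (remQuot-combine w v))

  ∣lift∣ : ∀ κ → ∣ lift κ ∣ ≡ ∑[ w < order H ] ∑[ v < order G ] ⟦ lookup S (combine v (κ w)) ⟧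
  ∣lift∣ κ = begin
    ∣ lift κ ∣
      ≡⟨ ∣∣≡sum (lift κ) ⟩
    sum (λ p → ⟦ lookup (lift κ) p ⟧)
      ≡⟨ sum-combine (order H) _ ⟩
    ∑[ w < order H ] ∑[ v < order G ] ⟦ lookup (lift κ) (combine w v) ⟧
      ≡⟨ (sum-cong-≗ λ w → sum-cong-≗ λ v → cong ⟦_⟧ (lookup-lift κ w v)) ⟩
    ∑[ w < order H ] ∑[ v < order G ] ⟦ lookup S (combine v (κ w)) ⟧ ∎
    where open ≡-Reasoning

  -- In each copy of `G` one lift takes one layer of `S` and the other lift takes the remaining
  -- layer, so together they contribute `∣ S ∣` per vertex of `H`.
  ∣lift∣+∣lift-opposite∣ : ∀ κ → ∣ lift κ ∣ + ∣ lift (opposite ∘ κ) ∣ ≡ order H * ∣ S ∣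
  ∣lift∣+∣lift-opposite∣ κ = begin
    ∣ lift κ ∣ + ∣ lift (opposite ∘ κ) ∣
      ≡⟨ cong₂ _+_ (∣lift∣ κ) (∣lift∣ (opposite ∘ κ)) ⟩
    ∑[ w < order H ] ∑[ v < order G ] s v (κ w) +
    ∑[ w < order H ] ∑[ v < order G ] s v (opposite (κ w))
      ≡⟨ ∑-distrib-+ (λ w → ∑[ v < order G ] s v (κ w)) _ ⟨
    ∑[ w < order H ] (∑[ v < order G ] s v (κ w) + ∑[ v < order G ] s v (opposite (κ w)))
      ≡⟨ (sum-cong-≗ λ w → trans (sym (∑-distrib-+ (λ v → s v (κ w)) _))
           (sum-cong-≗ λ v → sum-opposite (κ w) (s v))) ⟩
    ∑[ w < order H ] ∑[ v < order G ] ∑[ x < 2 ] s v x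
      ≡⟨ sum-const (order H) _ ⟩
    order H * (∑[ v < order G ] ∑[ x < 2 ] s v x)
      ≡⟨ cong (order H *_) (trans (∣∣≡sum S) (sum-combine (order G) _)) ⟨
    order H * ∣ S ∣ ∎
    where
    open ≡-Reasoning
    s : Vertex G → Fin 2 → ℕ
    s v x = ⟦ lookup S (combine v x) ⟧

  module _ {κ : Vertex H → Fin 2} (proper : Proper₂ H κ) where

    -- The projection is a graph homomorphism: an edge inside a copy stays within one layer, and a
    -- matching edge changes layer because `κ` is proper.
    layer-adj : ∀ {p q} → μAdj G H p q → Adj (G □ K 2) (layer p κ) (layer q κ)
    layer-adj {w₁ , v₁} {w₂ , v₂} e =
      subst₂ (□Adj G (K 2)) (sym (remQuot-combine v₁ (κ w₁)))
        (sym (remQuot-combine v₂ (κ w₂))) (adj e)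
      where
      adj : ∀ {w₁ w₂ v₁ v₂} → μAdj G H (w₁ , v₁) (w₂ , v₂) →
            □Adj G (K 2) (v₁ , κ w₁) (v₂ , κ w₂)
      adj (inCopy e) = inj₂ (e , refl)
      adj {w₁} {w₂} (matching e) =
        inj₁ (refl , λ eq → opposite-≢ (κ w₁) (trans eq (proper w₁ w₂ e)))

    inCopyCount : Vertex H × Vertex G → ℕ
    inCopyCount (w , v) =
      ∑[ v′ < order G ] ⟦ does (adj? G v v′) ∧ lookup S (combine v′ (κ w)) ⟧

    -- By properness, every matching neighbour of `(w , v)` projects to this one vertex of
    -- `G □ K 2`, so these neighbours lie in `lift κ` all together or not at all.
    matched : Vertex H × Vertex G → Bool
    matched (w , v) = lookup S (combine v (opposite (κ w)))

    neighboursIn-layer : ∀ q →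
      neighboursIn (G □ K 2) S (layer q κ) ≡ ⟦ matched q ⟧ + inCopyCount q
    neighboursIn-layer (w , v) =
      trans (neighboursIn-□ G (K 2) S (combine v (κ w)) (remQuot-combine v (κ w)))
            (cong (_+ inCopyCount (w , v)) (sum-K₂ (κ w) (λ y → lookup S (combine v y))))

    -- The decision procedures of μ[ G , H ] and H □ G have the same boolean values,
    -- so their neighbour counts agree definitionally.
    neighboursIn-lift : ∀ p → let q = remQuot (order G) p in
      neighboursIn μ[ G , H ] (lift κ) p ≡
        degree H (proj₁ q) * ⟦ matched q ⟧ + inCopyCount q
    neighboursIn-lift p = begin
      neighboursIn (H □ G) (lift κ) p
        ≡⟨ neighboursIn-□ H G (lift κ) p refl ⟩
      ∑[ v′ < order G ] ⟦ does (adj? G v v′) ∧ lookup (lift κ) (combine w v′) ⟧ +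
      ∑[ w′ < order H ] ⟦ does (adj? H w w′) ∧ lookup (lift κ) (combine w′ v) ⟧
        ≡⟨ cong₂ _+_
             (sum-cong-≗ λ v′ → cong (λ b → ⟦ does (adj? G v v′) ∧ b ⟧) (lookup-lift κ w v′))
             (sum-cong-≗ matching-term) ⟩
      inCopyCount (w , v) + ∑[ w′ < order H ] (⟦ does (adj? H w w′) ⟧ * ⟦ matched (w , v) ⟧)
        ≡⟨ +-comm (inCopyCount (w , v)) _ ⟩
      ∑[ w′ < order H ] (⟦ does (adj? H w w′) ⟧ * ⟦ matched (w , v) ⟧) + inCopyCount (w , v)
        ≡⟨ cong (_+ inCopyCount (w , v)) (*-distribʳ-sum ⟦ matched (w , v) ⟧ (λ w′ → ⟦ does (adj? H w w′) ⟧)) ⟨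
      (∑[ w′ < order H ] ⟦ does (adj? H w w′) ⟧) * ⟦ matched (w , v) ⟧ + inCopyCount (w , v)
        ≡⟨ cong (λ d → d * ⟦ matched (w , v) ⟧ + inCopyCount (w , v)) (∣tabulate∣≡sum (λ w′ → does (adj? H w w′))) ⟨
      degree H w * ⟦ matched (w , v) ⟧ + inCopyCount (w , v) ∎
      where
      open ≡-Reasoning
      w = proj₁ (remQuot {order H} (order G) p)
      v = proj₂ (remQuot {order H} (order G) p)
      matching-term : ∀ w′ → ⟦ does (adj? H w w′) ∧ lookup (lift κ) (combine w′ v) ⟧ ≡
                             ⟦ does (adj? H w w′) ⟧ * ⟦ matched (w , v) ⟧
      matching-term w′ rewrite lookup-lift κ w′ v with adj? H w w′
      ... | no  _ = refl
      ... | yes e rewrite proper w w′ e = sym (*-identityˡ _)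

    -- Both conditions pull back along `layer`: independence because edges map to edges, the odd
    -- condition because the two neighbour counts differ only by the odd factor `degree H w` on the
    -- matched term.
    lift-oddIndependent : AllDegreesOdd H → OddIndependent (G □ K 2) S →
                          OddIndependent μ[ G , H ] (lift κ)
    lift-oddIndependent odd (indep , nbrs) =
      (λ p q p∈ q∈ e → indep _ _ (∈-lift⁻ κ p p∈) (∈-lift⁻ κ q q∈) (layer-adj e)) ,
      λ p p∉ → let q = remQuot (order G) p in
        subst (λ k → k ≡ 0 ⊎ Odd k) (sym (neighboursIn-lift p))
          (0-or-odd-* (degree H (proj₁ q)) (odd (proj₁ q)) (matched q) (inCopyCount q)
            (subst (λ k → k ≡ 0 ⊎ Odd k) (neighboursIn-layer q)
              (nbrs (layer q κ) (p∉ ∘ ∈-lift⁺ κ p))))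

-- The bound from a colouring and its opposite.

side : Bool → Fin 2
side false = zero
side true  = suc zero

side-≢ : ∀ {a b} → a ≢ b → side b ≡ opposite (side a)
side-≢ {false} {false} a≢b = contradiction refl a≢b
side-≢ {false} {true}  _   = refl
side-≢ {true}  {false} _   = refl
side-≢ {true}  {true}  a≢b = contradiction refl a≢b

theorem4 : (G H : Graph) → Bipartite H → AllDegreesOdd H →
    Graph.order H * α-od (G □ K 2) ≤ 2 * α-od μ[ G , H ]
theorem4 G H (colour , colour-≢) odd with α-od-attained (G □ K 2)
... | S , oi , ∣S∣≡α = begin
  order H * α-od (G □ K 2)
    ≡⟨ cong (order H *_) ∣S∣≡α ⟨
  order H * ∣ S ∣
    ≡⟨ ∣lift∣+∣lift-opposite∣ G H S κ ⟨
  ∣ lift G H S κ ∣ + ∣ lift G H S (opposite ∘ κ) ∣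
    -- Each of the two lifts is bounded by `α-od` separately, which gives the factor 2 without
    -- comparing their sizes.
    ≤⟨ +-mono-≤ (bound proper) (bound (opposite-proper H proper)) ⟩
  α-od μ[ G , H ] + α-od μ[ G , H ]
    ≡⟨ cong (α-od μ[ G , H ] +_) (+-identityʳ _) ⟨
  2 * α-od μ[ G , H ] ∎
  where
  open ≤-Reasoning
  κ : Vertex H → Fin 2
  κ = side ∘ colour
  proper : Proper₂ H κ
  proper u v e = side-≢ (colour-≢ u v e)
  bound : ∀ {κ} → Proper₂ H κ → ∣ lift G H S κ ∣ ≤ α-od μ[ G , H ]
  bound pr = α-od-upper μ[ G , H ] _ (lift-oddIndependent G H S pr odd oi)
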